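{- Let $W\ge1$ be an integer and let $\epsilon>0$ be such that $k=\frac{1}{2\epsilon}$ and $\frac{W}{k}$ are integers. Then Algorithm 1 (described in the context, run with these parameters) provides a $W\epsilon$-additive approximation of Basic-Counting; that is, for every input bit stream and at every time, the value $\widehat{C^W}$ returned by Query satisfies $|\widehat{C^W}-C^W|\le W\epsilon$.
   Context: Basic-Counting: given a stream of bits arriving one at a time and a window size $W$, maintain $C^W$, the number of 1's among the last $W$ bits of the stream (bits before the beginning of the stream are regarded as 0). Algorithm 1. Variables: integers $y,m,i,B$ and a bit array $b=(b_0,\dots,b_{k-1})$, all initialized to $0$. Add(bit $x$): If $m=\frac Wk-1$, then do in order: (1) $B\leftarrow B-b_i$; (2) if $y+x\ge\frac Wk$, set $b_i\leftarrow1$ and $y\leftarrow y-\frac Wk+x$; otherwise set $b_i\leftarrow0$ and $y\leftarrow y+x$; (3) $B\leftarrow B+b_i$; (4) $m\leftarrow0$; (5) $i\leftarrow i+1 \bmod k$. Otherwise (if $m\neq\frac Wk-1$): $y\leftarrow y+x$ and $m\leftarrow m+1$. Query: return $\frac Wk\cdot B+y-\frac{W}{2k}-m\cdot b_i$. Each arriving stream bit is processed by one call of Add. -}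

module Defs where

open import Data.Bool.Base using (Bool; true; false; if_then_else_)
open import Data.Fin.Base using (Fin; toℕ)
open import Data.Integer.Base as ℤ using (ℤ; +_; 0ℤ; 1ℤ)
import Data.Integer.Properties as ℤ
open import Data.List.Base using (applyUpTo)
open import Data.Nat.Base as ℕ using (ℕ; zero; suc; NonZero)
open import Data.Nat.DivMod using (_mod_)
import Data.Nat.DivMod as ℕ
open import Data.Nat.ListAction using (sum)
import Data.Nat.Properties as ℕ
open import Data.Rational.Base as ℚ using (ℚ; Positive)
import Data.Rational.Properties as ℚ
open import Data.Vec.Base using (Vec; replicate; lookup; _[_]≔_)
open import Relation.Nullary.Decidable.Core using (does)

fromℤ : ℤ → ℚ
fromℤ z = z ℚ./ 1

fromℕ : ℕ → ℚ
fromℕ n = fromℤ (+ n)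

1/[2*_] : (ε : ℚ) .{{_ : Positive ε}} → ℚ
1/[2* ε ] = (ℚ.1/ 2ε) {{ℚ.pos⇒nonZero 2ε {{ℚ.pos*pos⇒pos (fromℕ 2) ε}}}}
  where 2ε = fromℕ 2 ℚ.* ε

bitℕ : Bool → ℕ
bitℕ false = 0
bitℕ true  = 1

bitℤ : Bool → ℤ
bitℤ x = + bitℕ x

-- s t is the bit arriving at step t, counted from 0; "at time t" means after
-- s 0 , … , s (t ∸ 1) have arrived.
Stream : Set
Stream = ℕ → Bool

-- recent s t j is the bit that arrived j steps before the latest one at time t;
-- it is 0 if that position lies before the beginning of the stream.
recent : Stream → ℕ → ℕ → Bool
recent s zero    j       = false
recent s (suc t) zero    = s t
recent s (suc t) (suc j) = recent s t j

basicCount : (W : ℕ) → Stream → (t : ℕ) → ℕ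
basicCount W s t = sum (applyUpTo (λ j → bitℕ (recent s t j)) W)

record State (k : ℕ) : Set where
  constructor state
  field
    y m B : ℤ
    i     : Fin k
    b     : Vec Bool k

-- The algorithm is only meant to be run when k divides W, in which case the
-- natural-number quotient W ℕ./ k is exact.
module Algorithm (W k : ℕ) .{{_ : NonZero k}} where

  W/k : ℤ
  W/k = + (W ℕ./ k)

  init : State k
  init = state 0ℤ 0ℤ 0ℤ (0 mod k) (replicate k false)

  add : Bool → State k → State k
  add x (state y m B i b) =
    if does (m ℤ.≟ W/k ℤ.- 1ℤ)
    then (let
            B₁       = B ℤ.- bitℤ (lookup b i)
            overflow = does (W/k ℤ.≤? y ℤ.+ bitℤ x)
            b′       = b [ i ]≔ overflow
            y′       = if overflow then y ℤ.- W/k ℤ.+ bitℤ x else y ℤ.+ bitℤ x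
            B₂       = B₁ ℤ.+ bitℤ (lookup b′ i)
          in state y′ 0ℤ B₂ (suc (toℕ i) mod k) b′)
    else state (y ℤ.+ bitℤ x) (m ℤ.+ 1ℤ) B i b

  query : State k → ℚ
  query (state y m B i b) =
    ((+ W) ℚ./ k) ℚ.* fromℤ B ℚ.+ fromℤ y
      ℚ.- ((+ W) ℚ./ (2 ℕ.* k)) {{ℕ.m*n≢0 2 k}}
      ℚ.- fromℤ m ℚ.* fromℤ (bitℤ (lookup b i))

  run : Stream → ℕ → State k
  run s zero    = init
  run s (suc t) = add (s t) (run s t)

  estimate : Stream → ℕ → ℚ
  estimate s t = query (run s t)

{-# OPTIONS --safe #-}
module Submission where

-- Write n = W / k and let P t be the number of 1's among the first t bits.  The
-- bits produced at the block boundaries are carries: after q blocks of length n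
-- their total is the quotient c q of P (q * n) by n (`carried`), and y holds the
-- remainder.  Hence at time t = r + q * n with r < n one has m = r,
-- P t = y + c q * n and B = c q - c (q - k), and the array entry at i is the bit
-- β = c (q - k + 1) - c (q - k) of block q - k, the block in which the window
-- starts; for blocks before the beginning of the stream c is 0.  This is
-- `Invariant`, which every call of `add` preserves.
--
-- The exact count is P t - P (t - W), so n * B + y - m * β exceeds it by
--   d = P (t - W) - c (q - k) * n - r * β,
-- where t - W lies at offset r of block q - k.  Then 0 ≤ d ≤ n
-- (`expired-error`).  If q < k, all terms of d are 0.  Otherwise, for β = 1, the block starts with a remainder below n,
-- and it ends with a total of at least n, of which at most n - r came after
-- offset r; for β = 0, the total stays below n throughout the block.  The query
-- subtracts W / 2k, which equals n / 2 = W * ε, and so centres the error in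
-- [ - W * ε , W * ε ].

open import Defs
open import Data.Bool.Base using (true; false; if_then_else_)
open import Data.Fin.Base using (toℕ)
import Data.Fin.Properties as Fin
open import Data.Integer.Base as ℤ using (ℤ; +_; 0ℤ; 1ℤ)
import Data.Integer.Properties as ℤ
import Data.Integer.Tactic.RingSolver as ℤ-Solver
open import Data.Nat.Base as ℕ using (ℕ; zero; suc; NonZero; _≥_; _∸_)
open import Data.Nat.Divisibility using (>⇒∤; ∣m+n∣m⇒∣n; divides-refl)
open import Data.Nat.Divisibility.Core using (_∣_; divides)
open import Data.Nat.DivMod using (_mod_)
import Data.Nat.DivMod as ℕ
import Data.Nat.Properties as ℕ
import Data.Nat.Tactic.RingSolver as ℕ-Solver
open import Data.Product.Base using (∃-syntax; _×_; _,_)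
open import Data.Rational.Base using (ℚ; Positive; 0ℚ; 1ℚ; _≤_; _+_; _-_; -_; _*_; ∣_∣; _/_; toℚᵘ)
import Data.Rational.Properties as ℚ
import Data.Rational.Solver as ℚ-Solver
open import Data.Rational.Unnormalised.Base as ℚᵘ using (mkℚᵘ; *≡*; *≤*)
import Data.Rational.Unnormalised.Properties as ℚᵘ
open import Data.Sum.Base using (inj₁; inj₂)
open import Data.Vec.Base using (lookup; _[_]≔_)
open import Data.Vec.Properties using (lookup∘update; lookup∘update′; lookup-replicate)
open import Function.Base using (_∘_)
open import Relation.Binary.PropositionalEquality
  using (_≡_; _≢_; refl; sym; trans; cong; cong₂; subst; module ≡-Reasoning)
open import Relation.Nullary using (yes; no; does)
open import Relation.Nullary.Decidable using (dec-true; dec-false)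

-- Prefix counts

-- The number of 1's among the first t bits.
ones : Stream → ℕ → ℕ
ones s zero    = 0
ones s (suc t) = bitℕ (s t) ℕ.+ ones s t

bitℕ≤1 : ∀ x → bitℕ x ℕ.≤ 1
bitℕ≤1 false = ℕ.z≤n
bitℕ≤1 true  = ℕ.≤-refl

ones-mono : ∀ s r t → ones s t ℕ.≤ ones s (r ℕ.+ t)
ones-mono s zero    t = ℕ.≤-refl
ones-mono s (suc r) t = ℕ.≤-trans (ones-mono s r t) (ℕ.m≤n+m _ (bitℕ (s (r ℕ.+ t))))

ones-growth : ∀ s r t → ones s (r ℕ.+ t) ℕ.≤ r ℕ.+ ones s t
ones-growth s zero    t = ℕ.≤-refl
ones-growth s (suc r) t = ℕ.+-mono-≤ (bitℕ≤1 (s (r ℕ.+ t))) (ones-growth s r t)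

basicCount-ones : ∀ W s t → basicCount W s t ℕ.+ ones s (t ∸ W) ≡ ones s t
basicCount-ones zero    s t       = refl
basicCount-ones (suc W) s zero    = trans (cong (basicCount W s zero ℕ.+_) (sym (cong (ones s) (ℕ.0∸n≡0 W))))
                                          (basicCount-ones W s zero)
basicCount-ones (suc W) s (suc t) = trans (ℕ.+-assoc (bitℕ (s t)) _ _)
                                          (cong (bitℕ (s t) ℕ.+_) (basicCount-ones W s t))

-- Carries at block boundaries

/-unique : ∀ n .{{_ : NonZero n}} {x a y} → x ≡ y ℕ.+ a ℕ.* n → y ℕ.< n → x ℕ./ n ≡ a
/-unique n {x} {a} {y} refl y<n = begin
  (y ℕ.+ a ℕ.* n) ℕ./ n           ≡⟨ ℕ.+-distrib-/-∣ʳ y (divides-refl a) ⟩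
  y ℕ./ n ℕ.+ a ℕ.* n ℕ./ n       ≡⟨ cong₂ ℕ._+_ (ℕ.m<n⇒m/n≡0 y<n) (ℕ.m*n/n≡m a n) ⟩
  a                               ∎
  where open ≡-Reasoning

module Blocks (n k : ℕ) .{{_ : NonZero n}} .{{_ : NonZero k}} (s : Stream) where

  -- The number of carries in the first q blocks of length n, that is, the sum of
  -- the bits that these blocks write into the array.
  carried : ℕ → ℕ
  carried q = ones s (q ℕ.* n) ℕ./ n

  -- The sum of the bits that have been overwritten after p blocks.  The truncated
  -- difference makes it 0 for p ≤ k, so expired (suc p) - expired p is the bit of
  -- block p - k, or 0 if there is no such block.
  expired : ℕ → ℕ
  expired p = carried (p ∸ k)

  carried-zero : carried 0 ≡ 0
  carried-zero = ℕ.0/n≡0 n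

  expired-early : ∀ {p} → p ℕ.≤ k → expired p ≡ 0
  expired-early p≤k = trans (cong carried (ℕ.m≤n⇒m∸n≡0 p≤k)) carried-zero

  carried*n≤ones : ∀ q → carried q ℕ.* n ℕ.≤ ones s (q ℕ.* n)
  carried*n≤ones q = ℕ.m/n*n≤m _ n

  ones<n+carried*n : ∀ q → ones s (q ℕ.* n) ℕ.< n ℕ.+ carried q ℕ.* n
  ones<n+carried*n q = subst (ℕ._< n ℕ.+ carried q ℕ.* n) (sym (ℕ.m≡m%n+[m/n]*n _ n))
                         (ℕ.+-monoˡ-< _ (ℕ.m%n<n _ n))

  -- Bounds on the number of 1's up to offset r of block q, whose bit is x.  Below:
  -- if x is 1, the count at the end of the block is at least (1 + carried q) * n,
  -- and at most n ∸ r of it come after offset r.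
  offset-lower : ∀ q r x → r ℕ.≤ n → carried (suc q) ≡ carried q ℕ.+ bitℕ x →
                 carried q ℕ.* n ℕ.+ r ℕ.* bitℕ x ℕ.≤ ones s (r ℕ.+ q ℕ.* n)
  offset-lower q r false r≤n eq = begin
    carried q ℕ.* n ℕ.+ r ℕ.* 0  ≡⟨ cong (carried q ℕ.* n ℕ.+_) (ℕ.*-zeroʳ r) ⟩
    carried q ℕ.* n ℕ.+ 0        ≡⟨ ℕ.+-identityʳ _ ⟩
    carried q ℕ.* n              ≤⟨ carried*n≤ones q ⟩
    ones s (q ℕ.* n)             ≤⟨ ones-mono s r _ ⟩
    ones s (r ℕ.+ q ℕ.* n)       ∎
    where open ℕ.≤-Reasoning
  offset-lower q r true r≤n eq = ℕ.+-cancelˡ-≤ (n ∸ r) _ _ (begin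
    (n ∸ r) ℕ.+ (carried q ℕ.* n ℕ.+ r ℕ.* 1) ≡⟨ rearrange (n ∸ r) (carried q ℕ.* n) r ⟩
    ((n ∸ r) ℕ.+ r) ℕ.+ carried q ℕ.* n       ≡⟨ cong (ℕ._+ carried q ℕ.* n) (ℕ.m∸n+n≡m r≤n) ⟩
    suc (carried q) ℕ.* n                     ≡⟨ cong (ℕ._* n) (trans eq (ℕ.+-comm (carried q) 1)) ⟨
    carried (suc q) ℕ.* n                     ≤⟨ carried*n≤ones (suc q) ⟩
    ones s (n ℕ.+ q ℕ.* n)                    ≡⟨ cong (λ l → ones s (l ℕ.+ q ℕ.* n)) (ℕ.m∸n+n≡m r≤n) ⟨
    ones s ((n ∸ r) ℕ.+ r ℕ.+ q ℕ.* n)        ≡⟨ cong (ones s) (ℕ.+-assoc (n ∸ r) r _) ⟩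
    ones s ((n ∸ r) ℕ.+ (r ℕ.+ q ℕ.* n))      ≤⟨ ones-growth s (n ∸ r) _ ⟩
    (n ∸ r) ℕ.+ ones s (r ℕ.+ q ℕ.* n)        ∎)
    where
    open ℕ.≤-Reasoning
    rearrange : ∀ a b c → a ℕ.+ (b ℕ.+ c ℕ.* 1) ≡ (a ℕ.+ c) ℕ.+ b
    rearrange = ℕ-Solver.solve-∀

  -- If x is 0, the count at the end of the block is still below
  -- (1 + carried q) * n; if x is 1, the count at its start is below that, and at
  -- most r more come before offset r.
  offset-upper : ∀ q r x → r ℕ.≤ n → carried (suc q) ≡ carried q ℕ.+ bitℕ x →
                 ones s (r ℕ.+ q ℕ.* n) ℕ.≤ n ℕ.+ (carried q ℕ.* n ℕ.+ r ℕ.* bitℕ x)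
  offset-upper q r false r≤n eq = begin
    ones s (r ℕ.+ q ℕ.* n)                  ≤⟨ ones-mono s (n ∸ r) _ ⟩
    ones s ((n ∸ r) ℕ.+ (r ℕ.+ q ℕ.* n))    ≡⟨ cong (ones s) (ℕ.+-assoc (n ∸ r) r _) ⟨
    ones s ((n ∸ r) ℕ.+ r ℕ.+ q ℕ.* n)      ≡⟨ cong (λ l → ones s (l ℕ.+ q ℕ.* n)) (ℕ.m∸n+n≡m r≤n) ⟩
    ones s (suc q ℕ.* n)                    ≤⟨ ℕ.<⇒≤ (ones<n+carried*n (suc q)) ⟩
    n ℕ.+ carried (suc q) ℕ.* n             ≡⟨ cong (λ c → n ℕ.+ c ℕ.* n) (trans eq (ℕ.+-identityʳ _)) ⟩
    n ℕ.+ carried q ℕ.* n                   ≤⟨ ℕ.+-monoʳ-≤ n (ℕ.m≤m+n _ _) ⟩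
    n ℕ.+ (carried q ℕ.* n ℕ.+ r ℕ.* 0)     ∎
    where open ℕ.≤-Reasoning
  offset-upper q r true r≤n eq = begin
    ones s (r ℕ.+ q ℕ.* n)                  ≤⟨ ones-growth s r _ ⟩
    r ℕ.+ ones s (q ℕ.* n)                  ≤⟨ ℕ.+-monoʳ-≤ r (ℕ.<⇒≤ (ones<n+carried*n q)) ⟩
    r ℕ.+ (n ℕ.+ carried q ℕ.* n)           ≡⟨ rearrange r n (carried q ℕ.* n) ⟩
    n ℕ.+ (carried q ℕ.* n ℕ.+ r ℕ.* 1)     ∎
    where
    open ℕ.≤-Reasoning
    rearrange : ∀ a b c → a ℕ.+ (b ℕ.+ c) ≡ b ℕ.+ (c ℕ.+ a ℕ.* 1)
    rearrange = ℕ-Solver.solve-∀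

  -- The number of 1's that have left the window of length n * k, minus what the
  -- overwritten bits and r times the oldest bit x account for, is between 0 and n.
  expired-error : ∀ q r x → r ℕ.< n → expired (suc q) ≡ expired q ℕ.+ bitℕ x →
                  ∃[ d ] d ℕ.≤ n ×
                    ones s ((r ℕ.+ q ℕ.* n) ∸ n ℕ.* k) ≡ d ℕ.+ (expired q ℕ.* n ℕ.+ r ℕ.* bitℕ x)
  expired-error q r x r<n eq with q ℕ.<? k
  -- The window reaches back to the beginning of the stream, and both sides are 0.
  ... | yes q<k = 0 , ℕ.z≤n , (begin
      ones s ((r ℕ.+ q ℕ.* n) ∸ n ℕ.* k)          ≡⟨ cong (ones s) (ℕ.m≤n⇒m∸n≡0 t≤W) ⟩
      0                                           ≡⟨ cong₂ ℕ._+_ (cong (ℕ._* n) expired≡0) (ℕ.*-zeroʳ r) ⟨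
      expired q ℕ.* n ℕ.+ r ℕ.* 0                 ≡⟨ cong (λ β → expired q ℕ.* n ℕ.+ r ℕ.* β) x≡0 ⟨
      expired q ℕ.* n ℕ.+ r ℕ.* bitℕ x            ∎)
    where
    open ≡-Reasoning
    expired≡0 : expired q ≡ 0
    expired≡0 = expired-early (ℕ.<⇒≤ q<k)
    x≡0 : bitℕ x ≡ 0
    x≡0 = trans (cong (ℕ._+ bitℕ x) (sym expired≡0)) (trans (sym eq) (expired-early q<k))
    t≤W : r ℕ.+ q ℕ.* n ℕ.≤ n ℕ.* k
    t≤W = ℕ.≤-trans (ℕ.+-monoˡ-≤ _ (ℕ.<⇒≤ r<n))
            (subst (suc q ℕ.* n ℕ.≤_) (ℕ.*-comm k n) (ℕ.*-monoˡ-≤ n q<k))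
  ... | no q≮k = ones s (r ℕ.+ p ℕ.* n) ∸ base , d≤n
               , trans (cong (ones s) t∸W) (sym (ℕ.m∸n+n≡m (offset-lower p r x (ℕ.<⇒≤ r<n) eq′)))
    where
    p = q ∸ k
    base = carried p ℕ.* n ℕ.+ r ℕ.* bitℕ x
    k≤q = ℕ.≮⇒≥ q≮k
    eq′ : carried (suc p) ≡ carried p ℕ.+ bitℕ x
    eq′ = trans (cong carried (sym (ℕ.+-∸-assoc 1 k≤q))) eq
    d≤n : ones s (r ℕ.+ p ℕ.* n) ∸ base ℕ.≤ n
    d≤n = ℕ.m≤n+o⇒m∸n≤o _ base
            (subst (ones s (r ℕ.+ p ℕ.* n) ℕ.≤_) (ℕ.+-comm n base) (offset-upper p r x (ℕ.<⇒≤ r<n) eq′))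
    t∸W : (r ℕ.+ q ℕ.* n) ∸ n ℕ.* k ≡ r ℕ.+ p ℕ.* n
    t∸W = begin
      (r ℕ.+ q ℕ.* n) ∸ n ℕ.* k    ≡⟨ cong ((r ℕ.+ q ℕ.* n) ∸_) (ℕ.*-comm n k) ⟩
      (r ℕ.+ q ℕ.* n) ∸ k ℕ.* n    ≡⟨ ℕ.+-∸-assoc r (ℕ.*-monoˡ-≤ n k≤q) ⟩
      r ℕ.+ (q ℕ.* n ∸ k ℕ.* n)    ≡⟨ cong (r ℕ.+_) (ℕ.*-distribʳ-∸ n q k) ⟨
      r ℕ.+ p ℕ.* n                ∎
      where open ≡-Reasoning

-- Indices modulo k

module _ {k : ℕ} .{{_ : NonZero k}} where

  toℕ-mod : ∀ a → toℕ (a mod k) ≡ a ℕ.% k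
  toℕ-mod a = Fin.toℕ-fromℕ< (ℕ.m%n<n a k)

  mod-cong : ∀ a b → a ℕ.% k ≡ b ℕ.% k → a mod k ≡ b mod k
  mod-cong a b eq = Fin.toℕ-injective (trans (toℕ-mod a) (trans eq (sym (toℕ-mod b))))

  suc-mod : ∀ q → suc (toℕ (q mod k)) mod k ≡ suc q mod k
  suc-mod q = mod-cong (suc (toℕ (q mod k))) (suc q) (begin
    suc (toℕ (q mod k)) ℕ.% k                  ≡⟨ cong (λ a → suc a ℕ.% k) (toℕ-mod q) ⟩
    (1 ℕ.+ q ℕ.% k) ℕ.% k                      ≡⟨ ℕ.%-distribˡ-+ 1 (q ℕ.% k) k ⟩
    (1 ℕ.% k ℕ.+ q ℕ.% k ℕ.% k) ℕ.% k          ≡⟨ cong (λ a → (1 ℕ.% k ℕ.+ a) ℕ.% k) (ℕ.m%n%n≡m%n q k) ⟩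
    (1 ℕ.% k ℕ.+ q ℕ.% k) ℕ.% k                ≡⟨ ℕ.%-distribˡ-+ 1 q k ⟨
    suc q ℕ.% k                                ∎)
    where open ≡-Reasoning

  mod-≢ : ∀ q j .{{_ : NonZero j}} → j ℕ.< k → (q ℕ.+ j) mod k ≢ q mod k
  mod-≢ q j j<k eq = >⇒∤ j<k (∣m+n∣m⇒∣n (divides ((q ℕ.+ j) ℕ./ k) multiple) (divides-refl (q ℕ./ k)))
    where
    open ≡-Reasoning
    multiple : q ℕ./ k ℕ.* k ℕ.+ j ≡ (q ℕ.+ j) ℕ./ k ℕ.* k
    multiple = ℕ.+-cancelˡ-≡ (q ℕ.% k) _ _ (begin
      q ℕ.% k ℕ.+ (q ℕ./ k ℕ.* k ℕ.+ j)                ≡⟨ ℕ.+-assoc (q ℕ.% k) _ j ⟨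
      q ℕ.% k ℕ.+ q ℕ./ k ℕ.* k ℕ.+ j                  ≡⟨ cong (ℕ._+ j) (ℕ.m≡m%n+[m/n]*n q k) ⟨
      q ℕ.+ j                                          ≡⟨ ℕ.m≡m%n+[m/n]*n (q ℕ.+ j) k ⟩
      (q ℕ.+ j) ℕ.% k ℕ.+ (q ℕ.+ j) ℕ./ k ℕ.* k        ≡⟨ cong (ℕ._+ (q ℕ.+ j) ℕ./ k ℕ.* k)
                                                            (trans (sym (toℕ-mod (q ℕ.+ j))) (trans (cong toℕ eq) (toℕ-mod q))) ⟩
      q ℕ.% k ℕ.+ (q ℕ.+ j) ℕ./ k ℕ.* k                ∎)

-- The invariant of the algorithm

module Run (W k : ℕ) .{{_ : NonZero k}} .{{_ : NonZero (W ℕ./ k)}} (s : Stream) where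
  open Algorithm W k

  n : ℕ
  n = W ℕ./ k

  open Blocks n k s

  add-inside : ∀ x m {y B i b} → m ≢ W/k ℤ.- 1ℤ →
               add x (state y m B i b) ≡ state (y ℤ.+ bitℤ x) (m ℤ.+ 1ℤ) B i b
  add-inside x m m≢ = cong (if_then _ else _) (dec-false (m ℤ.≟ W/k ℤ.- 1ℤ) m≢)

  add-end : ∀ x o y {m B i b} → m ≡ W/k ℤ.- 1ℤ → does (W/k ℤ.≤? y ℤ.+ bitℤ x) ≡ o →
            add x (state y m B i b) ≡
            state (if o then y ℤ.- W/k ℤ.+ bitℤ x else y ℤ.+ bitℤ x) 0ℤ
                  (B ℤ.- bitℤ (lookup b i) ℤ.+ bitℤ o) (suc (toℕ i) mod k) (b [ i ]≔ o)
  add-end x o y {m} {B} {i} {b} m≡ refl =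
    trans (cong (if_then _ else _) (dec-true (m ℤ.≟ W/k ℤ.- 1ℤ) m≡))
      (cong (λ β → state _ 0ℤ (B ℤ.- bitℤ (lookup b i) ℤ.+ bitℤ β) (suc (toℕ i) mod k) (b [ i ]≔ o)) (lookup∘update i b o))

  -- The state after t = r + q * n bits, that is, at offset r of block q; y₀ is
  -- the value of y as a natural number.  The array entry at p mod k, for
  -- p = q , … , q + k - 1, is the bit of block p - k, or 0 if there is no such
  -- block.
  record Invariant (t : ℕ) (σ : State k) : Set where
    constructor invariant
    open State σ
    field
      q r y₀ : ℕ
      t≡     : t ≡ r ℕ.+ q ℕ.* n
      r<n    : r ℕ.< n
      m≡     : m ≡ + r
      i≡     : i ≡ q mod k
      y≡     : y ≡ + y₀
      ones≡  : ones s t ≡ y₀ ℕ.+ carried q ℕ.* n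
      B≡     : + carried q ≡ B ℤ.+ + expired q
      buffer : ∀ j → j ℕ.< k →
               expired (suc (q ℕ.+ j)) ≡ expired (q ℕ.+ j) ℕ.+ bitℕ (lookup b ((q ℕ.+ j) mod k))

    -- The entry about to be overwritten.
    oldest : expired (suc q) ≡ expired q ℕ.+ bitℕ (lookup b i)
    oldest rewrite i≡ =
      subst (λ p → expired (suc p) ≡ expired p ℕ.+ bitℕ (lookup b (p mod k))) (ℕ.+-identityʳ q)
            (buffer 0 (ℕ.>-nonZero⁻¹ k))

  init-invariant : Invariant 0 init
  init-invariant = record
    { q = 0 ; r = 0 ; y₀ = 0 ; t≡ = refl ; r<n = ℕ.>-nonZero⁻¹ n ; m≡ = refl ; i≡ = refl ; y≡ = refl
    ; ones≡ = sym (cong (ℕ._* n) carried-zero)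
    ; B≡ = trans (cong (+_ ∘ carried) (sym (ℕ.0∸n≡0 k))) (sym (ℤ.+-identityˡ _))
    ; buffer = λ j j<k → trans (expired-early j<k)
        (sym (cong₂ ℕ._+_ (expired-early (ℕ.<⇒≤ j<k)) (cong bitℕ (lookup-replicate (j mod k) false))))
    }

  -- Writing o at q mod k = (q + k) mod k replaces the entry for p = q by the one
  -- for p = q + k, and moves the range of valid p from q to suc q.
  buffer-step : ∀ q b o →
    (∀ j → j ℕ.< k → expired (suc (q ℕ.+ j)) ≡ expired (q ℕ.+ j) ℕ.+ bitℕ (lookup b ((q ℕ.+ j) mod k))) →
    carried (suc q) ≡ carried q ℕ.+ bitℕ o →
    ∀ j → j ℕ.< k → expired (suc (suc q ℕ.+ j)) ≡
      expired (suc q ℕ.+ j) ℕ.+ bitℕ (lookup (b [ q mod k ]≔ o) ((suc q ℕ.+ j) mod k))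
  buffer-step q b o buffer new j j<k rewrite sym (ℕ.+-suc q j) with suc j ℕ.≟ k
  ... | no 1+j≢k = trans (buffer (suc j) 1+j<k)
          (cong (λ β → expired (q ℕ.+ suc j) ℕ.+ bitℕ β) (sym (lookup∘update′ (mod-≢ q (suc j) 1+j<k) b o)))
    where 1+j<k = ℕ.≤∧≢⇒< j<k 1+j≢k
  ... | yes refl = begin
    carried (suc (q ℕ.+ k) ∸ k)      ≡⟨ cong carried (ℕ.m+n∸n≡m (suc q) k) ⟩
    carried (suc q)                  ≡⟨ new ⟩
    carried q ℕ.+ bitℕ o             ≡⟨ cong₂ (λ c β → c ℕ.+ bitℕ β)
                                          (cong carried (sym (ℕ.m+n∸n≡m q k))) (sym newest) ⟩
    expired (q ℕ.+ k) ℕ.+ bitℕ (lookup (b [ q mod k ]≔ o) ((q ℕ.+ k) mod k)) ∎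
    where
    open ≡-Reasoning
    newest : lookup (b [ q mod k ]≔ o) ((q ℕ.+ k) mod k) ≡ o
    newest = trans (cong (lookup (b [ q mod k ]≔ o)) (mod-cong (q ℕ.+ k) q (ℕ.[m+n]%n≡m%n q k)))
                   (lookup∘update (q mod k) b o)

  -- The comparison at the end of block q yields the bit o that carried grows by.
  -- Here z = y + x is the counter before the possible carry, and y₁ after it.
  carry : ∀ q z → z ℕ.< n ℕ.+ n → ones s (suc q ℕ.* n) ≡ z ℕ.+ carried q ℕ.* n →
          ∃[ o ] ∃[ y₁ ] does (W/k ℤ.≤? + z) ≡ o × z ≡ bitℕ o ℕ.* n ℕ.+ y₁ ×
            carried (suc q) ≡ carried q ℕ.+ bitℕ o ×
            ones s (suc q ℕ.* n) ≡ y₁ ℕ.+ carried (suc q) ℕ.* n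
  carry q z z<2n eq with n ℕ.≤? z
  ... | no n≰z = false , z , dec-false (W/k ℤ.≤? + z) (n≰z ∘ ℤ.drop‿+≤+) , refl
      , trans same (sym (ℕ.+-identityʳ _)) , trans eq (cong (λ c → z ℕ.+ c ℕ.* n) (sym same))
    where
    same : carried (suc q) ≡ carried q
    same = /-unique n eq (ℕ.≰⇒> n≰z)
  ... | yes n≤z = true , z ∸ n , dec-true (W/k ℤ.≤? + z) (ℤ.+≤+ n≤z)
      , trans (sym (ℕ.m+[n∸m]≡n n≤z)) (cong (ℕ._+ (z ∸ n)) (sym (ℕ.+-identityʳ n)))
      , trans next (ℕ.+-comm 1 _) , trans eq′ (cong (λ c → z ∸ n ℕ.+ c ℕ.* n) (sym next))
    where
    eq′ : ones s (suc q ℕ.* n) ≡ (z ∸ n) ℕ.+ suc (carried q) ℕ.* n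
    eq′ = trans eq (trans (cong (ℕ._+ carried q ℕ.* n) (sym (ℕ.m∸n+n≡m n≤z))) (ℕ.+-assoc (z ∸ n) n _))
    next : carried (suc q) ≡ suc (carried q)
    next = /-unique n eq′ (ℕ.+-cancelˡ-< n _ _ (subst (ℕ._< n ℕ.+ n) (sym (ℕ.m+[n∸m]≡n n≤z)) z<2n))

  private
    +-exchange : ∀ a b c → a ℕ.+ (b ℕ.+ c) ≡ b ℕ.+ a ℕ.+ c
    +-exchange = ℕ-Solver.solve-∀

  add-invariant : ∀ {t σ} → Invariant t σ → Invariant (suc t) (add (s t) σ)
  add-invariant {σ = state _ _ B _ b} inv@(invariant q r y₀ refl r<n refl refl refl ones≡ B≡ buffer)
    with suc r ℕ.≟ n
  ... | no 1+r≢n = subst (Invariant _) (sym (add-inside x (+ r) {+ y₀} m≢)) record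
      { q = q ; r = suc r ; y₀ = y₀ ℕ.+ bitℕ x ; t≡ = refl ; r<n = ℕ.≤∧≢⇒< r<n 1+r≢n
      ; m≡ = cong +_ (ℕ.+-comm r 1) ; i≡ = refl ; y≡ = refl
      ; ones≡ = trans (cong (bitℕ x ℕ.+_) ones≡) (+-exchange (bitℕ x) y₀ _)
      ; B≡ = B≡ ; buffer = buffer }
    where
    x = s (r ℕ.+ q ℕ.* n)
    m≢ : + r ≢ W/k ℤ.- 1ℤ
    m≢ eq = 1+r≢n (ℤ.+-injective (trans (cong ℤ.suc eq) (cancel W/k)))
      where
      cancel : ∀ a → 1ℤ ℤ.+ (a ℤ.- 1ℤ) ≡ a
      cancel = ℤ-Solver.solve-∀
  ... | yes 1+r≡n with carry q (y₀ ℕ.+ bitℕ x) z<2n ones-end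
    where
    x = s (r ℕ.+ q ℕ.* n)
    ones-end : ones s (suc q ℕ.* n) ≡ y₀ ℕ.+ bitℕ x ℕ.+ carried q ℕ.* n
    ones-end = trans (cong (λ l → ones s (l ℕ.+ q ℕ.* n)) (sym 1+r≡n))
                     (trans (cong (bitℕ x ℕ.+_) ones≡) (+-exchange (bitℕ x) y₀ _))
    -- The counter starts the block below n and grows by at most n, so one carry suffices.
    z<2n : y₀ ℕ.+ bitℕ x ℕ.< n ℕ.+ n
    z<2n = ℕ.+-cancelʳ-< (carried q ℕ.* n) _ _ (begin-strict
      y₀ ℕ.+ bitℕ x ℕ.+ carried q ℕ.* n  ≡⟨ ones-end ⟨
      ones s (n ℕ.+ q ℕ.* n)             ≤⟨ ones-growth s n _ ⟩
      n ℕ.+ ones s (q ℕ.* n)             <⟨ ℕ.+-monoʳ-< n (ones<n+carried*n q) ⟩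
      n ℕ.+ (n ℕ.+ carried q ℕ.* n)      ≡⟨ ℕ.+-assoc n n _ ⟨
      n ℕ.+ n ℕ.+ carried q ℕ.* n        ∎)
      where open ℕ.≤-Reasoning
  ...   | o , y₁ , test , z≡ , new , ones≡′ = subst (Invariant _) (sym (add-end x o (+ y₀) m≡ test)) record
      { q = suc q ; r = 0 ; y₀ = y₁ ; t≡ = cong (ℕ._+ q ℕ.* n) 1+r≡n ; r<n = ℕ.>-nonZero⁻¹ n
      ; m≡ = refl ; i≡ = suc-mod q ; y≡ = y≡′ o z≡
      ; ones≡ = trans (cong (λ l → ones s (l ℕ.+ q ℕ.* n)) 1+r≡n) ones≡′
      ; B≡ = B≡′ ; buffer = buffer-step q b o buffer new }
    where
    x = s (r ℕ.+ q ℕ.* n)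
    m≡ : + r ≡ W/k ℤ.- 1ℤ
    m≡ = trans (cancel (+ r)) (cong (λ l → + l ℤ.- 1ℤ) 1+r≡n)
      where
      cancel : ∀ a → a ≡ (1ℤ ℤ.+ a) ℤ.- 1ℤ
      cancel = ℤ-Solver.solve-∀
    y≡′ : ∀ o → y₀ ℕ.+ bitℕ x ≡ bitℕ o ℕ.* n ℕ.+ y₁ →
          (if o then + y₀ ℤ.- W/k ℤ.+ bitℤ x else + y₀ ℤ.+ bitℤ x) ≡ + y₁
    y≡′ false z≡ = cong +_ z≡
    y≡′ true  z≡ = begin
      + y₀ ℤ.- W/k ℤ.+ bitℤ x       ≡⟨ swap (+ y₀) W/k (bitℤ x) ⟩
      + (y₀ ℕ.+ bitℕ x) ℤ.- W/k     ≡⟨ cong (λ l → + l ℤ.- W/k)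
                                         (trans z≡ (cong (ℕ._+ y₁) (ℕ.+-identityʳ n))) ⟩
      (W/k ℤ.+ + y₁) ℤ.- W/k        ≡⟨ cancel W/k (+ y₁) ⟩
      + y₁                          ∎
      where
      open ≡-Reasoning
      swap : ∀ a b c → a ℤ.- b ℤ.+ c ≡ (a ℤ.+ c) ℤ.- b
      swap = ℤ-Solver.solve-∀
      cancel : ∀ a b → (a ℤ.+ b) ℤ.- a ≡ b
      cancel = ℤ-Solver.solve-∀
    B≡′ : + carried (suc q) ≡ B ℤ.- bitℤ (lookup b (q mod k)) ℤ.+ bitℤ o ℤ.+ + expired (suc q)
    B≡′ = begin
      + carried (suc q)                            ≡⟨ cong +_ new ⟩
      + carried q ℤ.+ bitℤ o                       ≡⟨ cong (ℤ._+ bitℤ o) B≡ ⟩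
      B ℤ.+ + expired q ℤ.+ bitℤ o                 ≡⟨ swap B (+ expired q) (bitℤ o) (bitℤ (lookup b (q mod k))) ⟩
      B ℤ.- bitℤ (lookup b (q mod k)) ℤ.+ bitℤ o ℤ.+ (+ expired q ℤ.+ bitℤ (lookup b (q mod k)))
        ≡⟨ cong (λ e → B ℤ.- bitℤ (lookup b (q mod k)) ℤ.+ bitℤ o ℤ.+ + e) (sym (Invariant.oldest inv)) ⟩
      B ℤ.- bitℤ (lookup b (q mod k)) ℤ.+ bitℤ o ℤ.+ + expired (suc q) ∎
      where
      open ≡-Reasoning
      swap : ∀ B e o l → B ℤ.+ e ℤ.+ o ≡ B ℤ.- l ℤ.+ o ℤ.+ (e ℤ.+ l)
      swap = ℤ-Solver.solve-∀

  run-invariant : ∀ t → Invariant t (run s t)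
  run-invariant zero    = init-invariant
  run-invariant (suc t) = add-invariant (run-invariant t)

  -- The query without its term W / 2k exceeds the exact count by d, where
  -- 0 ≤ d ≤ n.
  error : n ℕ.* k ≡ W → ∀ {t σ} → Invariant t σ → let open State σ in
          ∃[ d ] d ℕ.≤ n ×
            + n ℤ.* B ℤ.+ y ℤ.- m ℤ.* bitℤ (lookup b i) ≡ + basicCount W s t ℤ.+ + d
  error nk≡W {t} {state _ _ B _ b} inv@(invariant q r y₀ refl r<n refl refl refl ones≡ B≡ buffer)
    with d , d≤n , gone ← expired-error q r (lookup b (q mod k)) r<n (Invariant.oldest inv)
    = d , d≤n , ℤ-eq
    where
    open ≡-Reasoning
    C β e : ℕ
    C = basicCount W s t
    β = bitℕ (lookup b (q mod k))
    e = expired q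
    balance : C ℕ.+ (d ℕ.+ (e ℕ.* n ℕ.+ r ℕ.* β)) ≡ y₀ ℕ.+ carried q ℕ.* n
    balance = begin
      C ℕ.+ (d ℕ.+ (e ℕ.* n ℕ.+ r ℕ.* β))   ≡⟨ cong (C ℕ.+_) gone ⟨
      C ℕ.+ ones s (t ∸ n ℕ.* k)            ≡⟨ cong (λ w → C ℕ.+ ones s (t ∸ w)) nk≡W ⟩
      C ℕ.+ ones s (t ∸ W)                  ≡⟨ basicCount-ones W s t ⟩
      ones s t                              ≡⟨ ones≡ ⟩
      y₀ ℕ.+ carried q ℕ.* n                ∎
    balanceℤ : + C ℤ.+ (+ d ℤ.+ (+ e ℤ.* + n ℤ.+ + r ℤ.* + β)) ≡ + y₀ ℤ.+ (B ℤ.+ + e) ℤ.* + n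
    balanceℤ = begin
      + C ℤ.+ (+ d ℤ.+ (+ e ℤ.* + n ℤ.+ + r ℤ.* + β))
        ≡⟨ cong (λ z → + C ℤ.+ (+ d ℤ.+ z)) (cong₂ ℤ._+_ (ℤ.pos-* e n) (ℤ.pos-* r β)) ⟨
      + (C ℕ.+ (d ℕ.+ (e ℕ.* n ℕ.+ r ℕ.* β)))   ≡⟨ cong +_ balance ⟩
      + y₀ ℤ.+ + (carried q ℕ.* n)              ≡⟨ cong (λ c → + y₀ ℤ.+ c) (ℤ.pos-* (carried q) n) ⟩
      + y₀ ℤ.+ + carried q ℤ.* + n              ≡⟨ cong (λ c → + y₀ ℤ.+ c ℤ.* + n) B≡ ⟩
      + y₀ ℤ.+ (B ℤ.+ + e) ℤ.* + n              ∎
    collect : ∀ n B y e r β → n ℤ.* B ℤ.+ y ℤ.- r ℤ.* β ≡ (y ℤ.+ (B ℤ.+ e) ℤ.* n) ℤ.- (e ℤ.* n ℤ.+ r ℤ.* β)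
    collect = ℤ-Solver.solve-∀
    cancel : ∀ C d z → (C ℤ.+ (d ℤ.+ z)) ℤ.- z ≡ C ℤ.+ d
    cancel = ℤ-Solver.solve-∀
    ℤ-eq : + n ℤ.* B ℤ.+ + y₀ ℤ.- + r ℤ.* + β ≡ + C ℤ.+ + d
    ℤ-eq = begin
      + n ℤ.* B ℤ.+ + y₀ ℤ.- + r ℤ.* + β
        ≡⟨ collect (+ n) B (+ y₀) (+ e) (+ r) (+ β) ⟩
      (+ y₀ ℤ.+ (B ℤ.+ + e) ℤ.* + n) ℤ.- (+ e ℤ.* + n ℤ.+ + r ℤ.* + β)
        ≡⟨ cong (ℤ._- (+ e ℤ.* + n ℤ.+ + r ℤ.* + β)) balanceℤ ⟨
      (+ C ℤ.+ (+ d ℤ.+ (+ e ℤ.* + n ℤ.+ + r ℤ.* + β))) ℤ.- (+ e ℤ.* + n ℤ.+ + r ℤ.* + β)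
        ≡⟨ cancel (+ C) (+ d) (+ e ℤ.* + n ℤ.+ + r ℤ.* + β) ⟩
      + C ℤ.+ + d                          ∎

-- Passing to the rationals

toℚᵘ-/ : ∀ z b .{{_ : NonZero b}} → toℚᵘ (z / b) ℚᵘ.≃ z ℚᵘ./ b
toℚᵘ-/ z (suc b) = ℚ.toℚᵘ-fromℚᵘ (mkℚᵘ z b)

/-*-cancel : ∀ z b .{{_ : NonZero b}} → z / b * fromℕ b ≡ fromℤ z
/-*-cancel z b@(suc _) = ℚ.toℚᵘ-injective (begin
  toℚᵘ (z / b * fromℕ b)               ≈⟨ ℚ.toℚᵘ-homo-* (z / b) (fromℕ b) ⟩
  toℚᵘ (z / b) ℚᵘ.* toℚᵘ (fromℕ b)     ≈⟨ ℚᵘ.*-cong (toℚᵘ-/ z b) (toℚᵘ-/ (+ b) 1) ⟩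
  z ℚᵘ./ b ℚᵘ.* (+ b ℚᵘ./ 1)           ≈⟨ *≡* (trans (ℤ.*-identityʳ _)
                                            (cong (z ℤ.*_) (cong +_ (sym (ℕ.*-identityʳ b))))) ⟩
  z ℚᵘ./ 1                             ≈⟨ toℚᵘ-/ z 1 ⟨
  toℚᵘ (fromℤ z)                       ∎)
  where open ℚᵘ.≃-Reasoning

fromℤ-+ : ∀ a b → fromℤ (a ℤ.+ b) ≡ fromℤ a + fromℤ b
fromℤ-+ a b = ℚ.toℚᵘ-injective (begin
  toℚᵘ (fromℤ (a ℤ.+ b))               ≈⟨ toℚᵘ-/ (a ℤ.+ b) 1 ⟩
  (a ℤ.+ b) ℚᵘ./ 1                     ≈⟨ *≡* (identities a b) ⟩
  a ℚᵘ./ 1 ℚᵘ.+ b ℚᵘ./ 1               ≈⟨ ℚᵘ.+-cong (toℚᵘ-/ a 1) (toℚᵘ-/ b 1) ⟨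
  toℚᵘ (fromℤ a) ℚᵘ.+ toℚᵘ (fromℤ b)   ≈⟨ ℚ.toℚᵘ-homo-+ (fromℤ a) (fromℤ b) ⟨
  toℚᵘ (fromℤ a + fromℤ b)             ∎)
  where
  open ℚᵘ.≃-Reasoning
  identities : ∀ a b → (a ℤ.+ b) ℤ.* 1ℤ ≡ (a ℤ.* 1ℤ ℤ.+ b ℤ.* 1ℤ) ℤ.* 1ℤ
  identities = ℤ-Solver.solve-∀

fromℤ-* : ∀ a b → fromℤ (a ℤ.* b) ≡ fromℤ a * fromℤ b
fromℤ-* a b = ℚ.toℚᵘ-injective (begin
  toℚᵘ (fromℤ (a ℤ.* b))               ≈⟨ toℚᵘ-/ (a ℤ.* b) 1 ⟩
  (a ℤ.* b) ℚᵘ./ 1                     ≈⟨ *≡* refl ⟩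
  a ℚᵘ./ 1 ℚᵘ.* (b ℚᵘ./ 1)             ≈⟨ ℚᵘ.*-cong (toℚᵘ-/ a 1) (toℚᵘ-/ b 1) ⟨
  toℚᵘ (fromℤ a) ℚᵘ.* toℚᵘ (fromℤ b)   ≈⟨ ℚ.toℚᵘ-homo-* (fromℤ a) (fromℤ b) ⟨
  toℚᵘ (fromℤ a * fromℤ b)             ∎)
  where open ℚᵘ.≃-Reasoning

fromℕ-* : ∀ a b → fromℕ (a ℕ.* b) ≡ fromℕ a * fromℕ b
fromℕ-* a b = trans (cong fromℤ (ℤ.pos-* a b)) (fromℤ-* (+ a) (+ b))

fromℕ-mono-≤ : ∀ {a b} → a ℕ.≤ b → fromℕ a ≤ fromℕ b
fromℕ-mono-≤ {a} {b} a≤b = ℚ.toℚᵘ-cancel-≤ (begin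
  toℚᵘ (fromℕ a)    ≃⟨ toℚᵘ-/ (+ a) 1 ⟩
  + a ℚᵘ./ 1        ≤⟨ *≤* (ℤ.*-monoʳ-≤-nonNeg 1ℤ (ℤ.+≤+ a≤b)) ⟩
  + b ℚᵘ./ 1        ≃⟨ toℚᵘ-/ (+ b) 1 ⟨
  toℚᵘ (fromℕ b)    ∎)
  where open ℚᵘ.≤-Reasoning

∣x-h∣≤h : ∀ {x} h → 0ℚ ≤ x → x ≤ h + h → ∣ x - h ∣ ≤ h
∣x-h∣≤h {x} h 0≤x x≤2h with ℚ.∣p∣≡p∨∣p∣≡-p (x - h)
... | inj₁ eq = begin
  ∣ x - h ∣      ≡⟨ eq ⟩
  x - h          ≤⟨ ℚ.+-monoˡ-≤ (- h) x≤2h ⟩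
  h + h - h      ≡⟨ solve 1 (λ h → h :+ h :- h := h) refl h ⟩
  h              ∎
  where
  open ℚ.≤-Reasoning
  open ℚ-Solver.+-*-Solver
... | inj₂ eq = begin
  ∣ x - h ∣      ≡⟨ eq ⟩
  - (x - h)      ≡⟨ solve 2 (λ x h → :- (x :- h) := h :- x) refl x h ⟩
  h - x          ≤⟨ ℚ.+-monoʳ-≤ h (ℚ.neg-antimono-≤ 0≤x) ⟩
  h + 0ℚ         ≡⟨ ℚ.+-identityʳ h ⟩
  h              ∎
  where
  open ℚ.≤-Reasoning
  open ℚ-Solver.+-*-Solver

theorem7 : (W : ℕ) → W ≥ 1 → (ε : ℚ) .{{_ : Positive ε}} → (k : ℕ) .{{_ : NonZero k}} → fromℕ k ≡ 1/[2* ε ] → k ∣ W → (s : Stream) (t : ℕ) → ∣ Algorithm.estimate W k s t - fromℕ (basicCount W s t) ∣ ≤ fromℕ W * ε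
theorem7 W W≥1 ε k k≡1/2ε k∣W s t = bound (Algorithm.run W k s t) (run-invariant t)
  where
  instance
    W/k≢0 : NonZero (W ℕ./ k)
    W/k≢0 = ℕ.≢-nonZero λ W/k≡0 →
      ℕ.<⇒≢ W≥1 (trans (sym (cong (ℕ._* k) W/k≡0)) (ℕ.m/n*n≡m k∣W))
  open Run W k s
  nk≡W : n ℕ.* k ≡ W
  nk≡W = ℕ.m/n*n≡m k∣W

  h : ℚ
  h = fromℕ W * ε

  k*2ε≡1 : fromℕ k * (fromℕ 2 * ε) ≡ 1ℚ
  k*2ε≡1 = trans (cong (_* (fromℕ 2 * ε)) k≡1/2ε)
                 (ℚ.*-inverseˡ (fromℕ 2 * ε) {{ℚ.pos⇒nonZero (fromℕ 2 * ε) {{ℚ.pos*pos⇒pos (fromℕ 2) ε}}}})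

  -- Multiplying by k * 2ε = 1 clears the denominators k and 2k below.
  insert-k*2ε : ∀ x → x ≡ x * fromℕ k * (fromℕ 2 * ε)
  insert-k*2ε x = trans (sym (ℚ.*-identityʳ x))
    (trans (cong (x *_) (sym k*2ε≡1)) (sym (ℚ.*-assoc x _ _)))

  W*2ε≡n : fromℕ W * (fromℕ 2 * ε) ≡ fromℕ n
  W*2ε≡n = begin
    fromℕ W * (fromℕ 2 * ε)              ≡⟨ cong (λ w → fromℕ w * (fromℕ 2 * ε)) nk≡W ⟨
    fromℕ (n ℕ.* k) * (fromℕ 2 * ε)      ≡⟨ cong (_* (fromℕ 2 * ε)) (fromℕ-* n k) ⟩
    fromℕ n * fromℕ k * (fromℕ 2 * ε)    ≡⟨ insert-k*2ε (fromℕ n) ⟨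
    fromℕ n                              ∎
    where open ≡-Reasoning

  h+h≡n : h + h ≡ fromℕ n
  h+h≡n = trans (double (fromℕ W) ε) W*2ε≡n
    where
    open ℚ-Solver.+-*-Solver
    double : ∀ w ε → w * ε + w * ε ≡ w * (fromℕ 2 * ε)
    double = solve 2 (λ w ε → w :* ε :+ w :* ε := w :* (con (fromℕ 2) :* ε)) refl

  W/k≡n : + W / k ≡ fromℕ n
  W/k≡n = trans (insert-k*2ε (+ W / k)) (trans (cong (_* (fromℕ 2 * ε)) (/-*-cancel (+ W) k)) W*2ε≡n)

  W/2k≡h : (+ W / (2 ℕ.* k)) {{ℕ.m*n≢0 2 k}} ≡ h
  W/2k≡h = begin
    W/2k                                 ≡⟨ insert-k*2ε W/2k ⟩
    W/2k * fromℕ k * (fromℕ 2 * ε)       ≡⟨ regroup W/2k (fromℕ k) (fromℕ 2) ε ⟩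
    W/2k * (fromℕ 2 * fromℕ k) * ε       ≡⟨ cong (λ x → W/2k * x * ε) (fromℕ-* 2 k) ⟨
    W/2k * fromℕ (2 ℕ.* k) * ε           ≡⟨ cong (_* ε) (/-*-cancel (+ W) (2 ℕ.* k) {{ℕ.m*n≢0 2 k}}) ⟩
    h                                    ∎
    where
    open ≡-Reasoning
    open ℚ-Solver.+-*-Solver
    W/2k = (+ W / (2 ℕ.* k)) {{ℕ.m*n≢0 2 k}}
    regroup : ∀ x k c ε → x * k * (c * ε) ≡ x * (c * k) * ε
    regroup = solve 4 (λ x k c ε → x :* k :* (c :* ε) := x :* (c :* k) :* ε) refl

  bound : ∀ σ → Invariant t σ → ∣ Algorithm.query W k σ - fromℕ (basicCount W s t) ∣ ≤ h
  bound σ@(state y m B i b) inv with d , d≤n , eq ← error nk≡W inv = begin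
    ∣ Algorithm.query W k σ - fromℕ C ∣  ≡⟨ cong ∣_∣ difference ⟩
    ∣ fromℕ d - h ∣                      ≤⟨ ∣x-h∣≤h h (fromℕ-mono-≤ {0} {d} ℕ.z≤n)
                                              (subst (fromℕ d ≤_) (sym h+h≡n) (fromℕ-mono-≤ {d} {n} d≤n)) ⟩
    h                                    ∎
    where
    open ℚ.≤-Reasoning
    C = basicCount W s t
    β = bitℤ (lookup b i)
    eqℚ : fromℕ n * fromℤ B + fromℤ y ≡ fromℕ C + fromℕ d + fromℤ m * fromℤ β
    eqℚ = begin-equality
      fromℕ n * fromℤ B + fromℤ y            ≡⟨ cong (_+ fromℤ y) (fromℤ-* (+ n) B) ⟨
      fromℤ (+ n ℤ.* B) + fromℤ y            ≡⟨ fromℤ-+ (+ n ℤ.* B) y ⟨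
      fromℤ (+ n ℤ.* B ℤ.+ y)                ≡⟨ cong fromℤ (uncancel (+ n ℤ.* B ℤ.+ y) (m ℤ.* β)) ⟩
      fromℤ (+ n ℤ.* B ℤ.+ y ℤ.- m ℤ.* β ℤ.+ m ℤ.* β)  ≡⟨ cong (λ z → fromℤ (z ℤ.+ m ℤ.* β)) eq ⟩
      fromℤ (+ C ℤ.+ + d ℤ.+ m ℤ.* β)        ≡⟨ fromℤ-+ (+ C ℤ.+ + d) (m ℤ.* β) ⟩
      fromℤ (+ C ℤ.+ + d) + fromℤ (m ℤ.* β)  ≡⟨ cong₂ _+_ (fromℤ-+ (+ C) (+ d)) (fromℤ-* m β) ⟩
      fromℕ C + fromℕ d + fromℤ m * fromℤ β  ∎
      where
      uncancel : ∀ a b → a ≡ a ℤ.- b ℤ.+ b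
      uncancel = ℤ-Solver.solve-∀
    cancel : ∀ C d h z → C + d + z - h - z - C ≡ d - h
    cancel = solve 4 (λ C d h z → C :+ d :+ z :- h :- z :- C := d :- h) refl
      where open ℚ-Solver.+-*-Solver
    difference : Algorithm.query W k σ - fromℕ C ≡ fromℕ d - h
    difference = begin-equality
      Algorithm.query W k σ - fromℕ C
        ≡⟨ cong₂ (λ u v → u * fromℤ B + fromℤ y - v - fromℤ m * fromℤ β - fromℕ C) W/k≡n W/2k≡h ⟩
      fromℕ n * fromℤ B + fromℤ y - h - fromℤ m * fromℤ β - fromℕ C
        ≡⟨ cong (λ u → u - h - fromℤ m * fromℤ β - fromℕ C) eqℚ ⟩
      fromℕ C + fromℕ d + fromℤ m * fromℤ β - h - fromℤ m * fromℤ β - fromℕ C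
        ≡⟨ cancel (fromℕ C) (fromℕ d) h (fromℤ m * fromℤ β) ⟩
      fromℕ d - h ∎
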